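{- Let $t\geq 1$ be an integer and let $A$ be a zero-one matrix which contains at most $t$ $1$-entries in each row. Then $\operatorname{ex}(n,A)\leq n^{2-\frac{1}{t}+o(1)}$ as $n\to\infty$ (with $t$ and $A$ fixed); that is, for every $\varepsilon>0$ there exists $n_0$ such that $\operatorname{ex}(n,A)\leq n^{2-\frac{1}{t}+\varepsilon}$ for all $n\geq n_0$.
   Context: A zero-one matrix is a (finite) matrix all of whose entries are $0$ or $1$. For zero-one matrices $A$ and $M$, we say that $M$ contains $A$ if, by deleting some (possibly no) rows and columns from $M$, and possibly turning some of its $1$-entries into $0$-entries, we can obtain $A$ (the order of the remaining rows and columns is kept). The weight of a zero-one matrix is the number of its $1$-entries. The extremal number $\operatorname{ex}(n,A)$ of a zero-one matrix $A$ is the maximum possible weight of an $n\times n$ zero-one matrix that does not contain $A$. -}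

module Defs where

open import Data.Bool.Base as Bool using (Bool; true; false)
import Data.Bool.Properties as Bool
open import Data.Fin.Base as Fin using (Fin; finToFun; funToFin)
import Data.Fin.Properties as Fin
open import Data.Integer.Base using (+_; -[1+_])
open import Data.List.Base as List using (List; []; _∷_; filter; cartesianProductWith)
open import Data.List.Extrema.Nat using (max; xs≤max; argmax-sel)
open import Data.List.Membership.Propositional using (_∈_)
open import Data.List.Membership.Propositional.Properties
  using (∈-cartesianProductWith⁺; ∈-filter⁺; ∈-filter⁻; ∈-map⁺; ∈-map⁻)
import Data.List.Relation.Unary.All as All
open import Data.List.Relation.Unary.Any using (here; there)
open import Data.Nat.Base using (ℕ; zero; suc; _*_; _^_; _≤_)
open import Data.Nat.Properties using (≤-trans; ≤-reflexive; n≤0⇒n≡0)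
open import Data.Product.Base using (∃; ∃₂; _×_; _,_)
open import Data.Rational.Unnormalised.Base using (ℚᵘ; mkℚᵘ)
open import Data.Sum.Base using (inj₁; inj₂)
open import Data.Vec.Base using (Vec; []; _∷_; lookup; tabulate; count; map; sum)
open import Data.Vec.Properties using (lookup∘tabulate)
open import Function.Base using (id; _∘_)
open import Relation.Binary.Core using (_Preserves_⟶_)
open import Relation.Binary.PropositionalEquality
open import Relation.Nullary.Decidable using (Dec; yes; no; map′; _×-dec_; _→-dec_; ¬?)
open import Relation.Nullary.Negation using (¬_)

------------------------------------------------------------------------
-- Zero-one matrices

-- k rows and l columns; `true` is the entry 1.
Matrix : ℕ → ℕ → Set
Matrix k l = Vec (Vec Bool l) k

private
  variable
    k l m n : ℕ

row : Matrix k l → Fin k → Vec Bool l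
row = lookup

entry : Matrix k l → Fin k → Fin l → Bool
entry M i j = lookup (row M i) j

ones : Vec Bool l → ℕ
ones = count (Bool._≟ true)

weight : Matrix k l → ℕ
weight M = sum (map ones M)

StrictlyIncreasing : (Fin k → Fin m) → Set
StrictlyIncreasing f = f Preserves Fin._<_ ⟶ Fin._<_

-- For strictly increasing r and c, this is what remains of M when the
-- rows outside the range of r and the columns outside the range of c
-- are deleted.
submatrix : Matrix m n → (Fin k → Fin m) → (Fin l → Fin n) → Matrix k l
submatrix M r c = tabulate λ i → tabulate λ j → entry M (r i) (c j)

-- A ⊑ B: turning some 1-entries of B into 0-entries gives A.
infix 4 _⊑_
_⊑_ : Matrix k l → Matrix k l → Set
A ⊑ B = ∀ i j → entry A i j Bool.≤ entry B i j

Contains : Matrix m n → Matrix k l → Set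
Contains {m} {n} {k} {l} M A =
  ∃₂ λ (r : Fin k → Fin m) (c : Fin l → Fin n) →
    StrictlyIncreasing r × StrictlyIncreasing c × A ⊑ submatrix M r c

------------------------------------------------------------------------
-- Containment is decidable

private
  entry-submatrix : (M : Matrix m n) (r : Fin k → Fin m) (c : Fin l → Fin n) →
    ∀ i j → entry (submatrix M r c) i j ≡ entry M (r i) (c j)
  entry-submatrix M r c i j = trans
    (cong (λ v → lookup v j) (lookup∘tabulate (λ i → tabulate λ j → entry M (r i) (c j)) i))
    (lookup∘tabulate (λ j → entry M (r i) (c j)) j)

  strictlyIncreasing? : (f : Fin k → Fin m) → Dec (StrictlyIncreasing f)
  strictlyIncreasing? f = map′ (λ h {i} {j} → h i j) (λ h i j → h {i} {j})
    (Fin.all? λ i → Fin.all? λ j → (i Fin.<? j) →-dec (f i Fin.<? f j))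

  strictlyIncreasing-resp : {f g : Fin k → Fin m} → f ≗ g →
    StrictlyIncreasing f → StrictlyIncreasing g
  strictlyIncreasing-resp f≗g h {i} {j} i<j = subst₂ Fin._<_ (f≗g i) (f≗g j) (h i<j)

  ⊑? : (A B : Matrix k l) → Dec (A ⊑ B)
  ⊑? A B = Fin.all? λ i → Fin.all? λ j → entry A i j Bool.≤? entry B i j

contains? : (M : Matrix m n) (A : Matrix k l) → Dec (Contains M A)
contains? {m} {n} {k} {l} M A = map′ to from
  (Fin.any? λ x → Fin.any? λ y →
    strictlyIncreasing? (fun x) ×-dec strictlyIncreasing? (fun y) ×-dec
    ⊑? A (submatrix M (fun x) (fun y)))
  where
  fun : ∀ {a b} → Fin (a ^ b) → Fin b → Fin a
  fun = finToFun

  Code : Set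
  Code = ∃ λ (x : Fin (m ^ k)) → ∃ λ (y : Fin (n ^ l)) →
    StrictlyIncreasing (fun x) × StrictlyIncreasing (fun y) ×
    A ⊑ submatrix M (fun x) (fun y)

  to : Code → Contains M A
  to (x , y , r↑ , c↑ , A⊑) = fun x , fun y , r↑ , c↑ , A⊑

  from : Contains M A → Code
  from (r , c , r↑ , c↑ , A⊑) = funToFin r , funToFin c
    , strictlyIncreasing-resp (sym ∘ r≗) r↑ , strictlyIncreasing-resp (sym ∘ c≗) c↑
    , λ i j → subst (entry A i j Bool.≤_) (eq i j) (A⊑ i j)
    where
    r≗ : fun (funToFin r) ≗ r
    r≗ = Fin.finToFun-funToFin r
    c≗ : fun (funToFin c) ≗ c
    c≗ = Fin.finToFun-funToFin c
    eq : ∀ i j → entry (submatrix M r c) i j ≡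
                 entry (submatrix M (fun (funToFin r)) (fun (funToFin c))) i j
    eq i j = trans (entry-submatrix M r c i j) (trans
      (cong₂ (entry M) (sym (r≗ i)) (sym (c≗ j)))
      (sym (entry-submatrix M (fun (funToFin r)) (fun (funToFin c)) i j)))

------------------------------------------------------------------------
-- The extremal number

allVecs : {X : Set} → List X → ∀ n → List (Vec X n)
allVecs xs zero    = [] ∷ []
allVecs xs (suc n) = cartesianProductWith _∷_ xs (allVecs xs n)

allMatrices : ∀ k l → List (Matrix k l)
allMatrices k l = allVecs (allVecs (false ∷ true ∷ []) l) k

avoiders : ∀ n → Matrix k l → List (Matrix n n)
avoiders n A = filter (λ M → ¬? (contains? M A)) (allMatrices n n)

-- The maximum of the empty set is taken to be 0: if A has no 1-entry,
-- every sufficiently large matrix contains A.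
ex : ℕ → Matrix k l → ℕ
ex n A = max 0 (List.map weight (avoiders n A))

private
  ∈-allVecs : {X : Set} {xs : List X} → (∀ x → x ∈ xs) → (v : Vec X n) → v ∈ allVecs xs n
  ∈-allVecs h []      = here refl
  ∈-allVecs h (x ∷ v) = ∈-cartesianProductWith⁺ _∷_ (h x) (∈-allVecs h v)

  ∈-allMatrices : (M : Matrix k l) → M ∈ allMatrices k l
  ∈-allMatrices = ∈-allVecs (∈-allVecs λ where
    false → here refl
    true  → there (here refl))

weight≤ex : (A : Matrix k l) (M : Matrix n n) → ¬ Contains M A → weight M ≤ ex n A
weight≤ex {n = n} A M M∌A =
  All.lookup (xs≤max 0 (List.map weight (avoiders n A)))
    (∈-map⁺ weight (∈-filter⁺ (λ N → ¬? (contains? N A)) (∈-allMatrices M) M∌A))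

ex-attained : (A : Matrix k l) (M : Matrix n n) → ¬ Contains M A →
  ∃ λ (N : Matrix n n) → ¬ Contains N A × weight N ≡ ex n A
ex-attained {n = n} A M M∌A with argmax-sel id 0 (List.map weight (avoiders n A))
... | inj₁ ex≡0 = M , M∌A , trans (n≤0⇒n≡0 (≤-trans (weight≤ex A M M∌A) (≤-reflexive ex≡0))) (sym ex≡0)
... | inj₂ ex∈ with ∈-map⁻ weight ex∈
...   | N , N∈ , eq with ∈-filter⁻ (λ K → ¬? (contains? K A)) {xs = allMatrices n n} N∈
...     | _ , N∌A = N , N∌A , sym eq

------------------------------------------------------------------------
-- Rational powers

-- x ≤ n ^^ q stands for the real inequality x ≤ n^q, with denominators
-- and negative exponents cleared: x ≤ n^(a/b) iff x^b ≤ n^a, and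
-- x ≤ n^(-a/b) iff x^b n^a ≤ 1.  (`mkℚᵘ a b` denotes a / (1 + b), and
-- the base n is meant to be positive if the exponent is not.)
infix 4 _≤_^^_
_≤_^^_ : ℕ → ℕ → ℚᵘ → Set
x ≤ n ^^ mkℚᵘ (+ a)    b = x ^ suc b ≤ n ^ a
x ≤ n ^^ mkℚᵘ -[1+ a ] b = x ^ suc b * n ^ suc a ≤ 1

{-# OPTIONS --safe #-}

-- Let N(r) be the set of columns in which row r of M has a 1.  For a t-set T
-- of columns, call h < D good for (T, r) if T ⊆ N(x) for some row x < r with
-- B^h ≤ r - x < B^(h+1), where n ≤ B^D.  A row x found at a larger h lies above
-- one found at a smaller h, so if r sees the same k good levels for all
-- t-subsets of a set of columns, then the k rows of A can be placed above r in
-- the right order, one per level.  Ramsey's theorem makes the sets of good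
-- levels agree on a subset of any large subset of N(r) whose t-subsets all have
-- at least k good levels.  Hence, if M avoids A, a positive proportion of the
-- t-subsets T of N(r) have fewer than k good levels.  On the other hand, every T
-- has at most 2^D B^k such rows r.  Comparing the two counts gives
-- weight M ≤ O(n^(2-1/t) B^(k/t)), and B^(k/t) is a small power of n for D large.
module Submission where

open import Defs
import Data.Bool.Properties as Bool
open import Data.Bool.Base as Bool using (Bool; true; false)
open import Data.Empty using (⊥-elim)
open import Data.Fin.Base as Fin using (Fin; zero; suc; toℕ; fromℕ<; _↑ˡ_)
import Data.Fin.Properties as Fin
open import Data.List.Base as List
  using (List; []; _∷_; _++_; length; take; drop; map; filter; tabulate; allFin)
open import Data.List.Extrema.Nat using (argmax-sel)
open import Data.List.Membership.Propositional using (_∈_)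
open import Data.List.Membership.Propositional.Properties using (∈-filter⁻; ∈-map⁻)
open import Data.List.Properties
  using (length-take; length-drop; take++drop≡id; map-cong; filter-accept; length-tabulate)
open import Data.List.Relation.Binary.Sublist.Propositional
  using (_⊆_; []; _∷_; _∷ʳ_; ⊆-refl; ⊆-trans; minimum)
open import Data.List.Relation.Binary.Sublist.Propositional.Properties
  using (take-⊆; ++⁺; ++⁺ˡ; All-resp-⊆; filter-⊆)
open import Data.List.Relation.Unary.All as All using (All; []; _∷_)
open import Data.List.Relation.Unary.All.Properties using (all-filter)
open import Data.List.Relation.Unary.AllPairs using (AllPairs; []; _∷_)
open import Data.List.Relation.Unary.AllPairs.Properties using (tabulate⁺-<)
open import Data.List.Relation.Unary.Any using (here; there)
open import Data.Nat.Base as ℕ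
  using (ℕ; zero; suc; _*_; _^_; _∸_; _⊔_; _≤_; _≥_; z≤n; s≤s; NonZero; >-nonZero⁻¹;
         ≢-nonZero⁻¹)
open import Data.Nat.ListAction using (sum)
open import Data.Nat.Properties
open import Data.Nat.Tactic.RingSolver using (solve-∀)
open import Data.Product.Base using (∃; _×_; _,_; proj₁; proj₂)
open import Data.Sum.Base as Sum using (_⊎_; inj₁; inj₂)
open import Data.Vec.Base as Vec using (Vec; []; _∷_; lookup; toList; fromList)
open import Data.Vec.Properties using (lookup∘tabulate; lookup-map; toList∘fromList)
open import Function.Base using (_∘_; id)
open import Relation.Binary.PropositionalEquality
open import Relation.Nullary.Decidable using (Dec; yes; no; _×-dec_; ¬?)
open import Relation.Nullary.Negation using (¬_; contradiction)

module _ where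

  -- In the theorem, _+_, _<_ and _/_ are the operations of ℚᵘ.
  open import Data.Nat.Base using (_+_; _<_; z<s; s<s; s<s⁻¹)
  open import Data.Nat.DivMod using (_/_; _%_; m≡m%n+[m/n]*n; m%n<n; m/n*n≤m)

  -- Ramsey's theorem

  private
    variable
      X : Set

  Homogeneous : (List X → Set) → ℕ → List X → Set
  Homogeneous P t ys = ∀ {T} → T ⊆ ys → length T ≡ t → P T

  -- An upper bound for the Ramsey numbers of two-coloured `t`-uniform hypergraphs. The successor
  -- pays for one vertex, and `ramseyNumber t m m` makes its link homogeneous on a list long enough
  -- for either recursive call.
  ramseyNumber : ℕ → ℕ → ℕ → ℕ
  ramseyNumber zero    p       q       = p ⊔ q
  ramseyNumber (suc t) zero    q       = 0
  ramseyNumber (suc t) (suc p) zero    = 0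
  ramseyNumber (suc t) (suc p) (suc q) =
    let m = ramseyNumber (suc t) p (suc q) ⊔ ramseyNumber (suc t) (suc p) q
    in suc (ramseyNumber t m m)

  take-length : ∀ {a} (xs : List X) → a ≤ length xs → length (take a xs) ≡ a
  take-length {a = a} xs a≤ = trans (length-take a xs) (m≤n⇒m⊓n≡m a≤)

  -- A sublist that uses `x` has its tail in `zs`, where the link of `x` is homogeneous; a sublist
  -- that omits `x` lies in `ys`.
  homogeneous-∷ : ∀ {P : List X → Set} {t x} {ys zs : List X} → ys ⊆ zs →
    Homogeneous (P ∘ (x ∷_)) t zs → Homogeneous P (suc t) ys → Homogeneous P (suc t) (x ∷ ys)
  homogeneous-∷ ys⊆zs h₁ h₂ (_ ∷ʳ T⊆)   len = h₂ T⊆ len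
  homogeneous-∷ ys⊆zs h₁ h₂ (refl ∷ T⊆) len = h₁ (⊆-trans T⊆ ys⊆zs) (suc-injective len)

  HomogeneousSublist : (List X → Set) → ℕ → ℕ → List X → Set
  HomogeneousSublist P t a xs = ∃ λ ys → ys ⊆ xs × length ys ≡ a × Homogeneous P t ys

  sublist-skip : ∀ {P : List X → Set} {t a x} {xs zs : List X} → zs ⊆ xs →
    HomogeneousSublist P t a zs → HomogeneousSublist P t a (x ∷ xs)
  sublist-skip zs⊆ (ys , ys⊆ , h) = ys , _ ∷ʳ ⊆-trans ys⊆ zs⊆ , h

  sublist-keep : ∀ {P : List X → Set} {t a x} {xs zs : List X} → zs ⊆ xs →
    Homogeneous (P ∘ (x ∷_)) t zs →
    HomogeneousSublist P (suc t) a zs → HomogeneousSublist P (suc t) (suc a) (x ∷ xs)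
  sublist-keep {P = P} zs⊆ hz (ys , ys⊆ , len , hy) =
    _ ∷ ys , refl ∷ ⊆-trans ys⊆ zs⊆ , cong suc len , homogeneous-∷ {P = P} ys⊆ hz hy

  Ramsey : (List X → Set) → ℕ → ℕ → ℕ → List X → Set
  Ramsey P t p q xs = HomogeneousSublist P t p xs ⊎ HomogeneousSublist (¬_ ∘ P) t q xs

  -- Search on inside the list `zs` on which the link of `x` has one colour. A list found in that
  -- colour can be extended by `x`; a list found in the other colour already has full length.
  ramsey-∷ : ∀ {P : List X → Set} {t p q m n x} {xs : List X} →
    Ramsey (P ∘ (x ∷_)) t (m ⊔ n) (m ⊔ n) xs →
    (∀ zs → m ≤ length zs → Ramsey P (suc t) p (suc q) zs) →
    (∀ zs → n ≤ length zs → Ramsey P (suc t) (suc p) q zs) →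
    Ramsey P (suc t) (suc p) (suc q) (x ∷ xs)
  ramsey-∷ {P = P} (inj₁ (zs , zs⊆ , eq , hz)) r₁ r₂ =
    Sum.map (sublist-keep {P = P} zs⊆ hz) (sublist-skip {P = ¬_ ∘ P} zs⊆)
      (r₁ zs (≤-trans (m≤m⊔n _ _) (≤-reflexive (sym eq))))
  ramsey-∷ {P = P} (inj₂ (zs , zs⊆ , eq , hz)) r₁ r₂ =
    Sum.map (sublist-skip {P = P} zs⊆) (sublist-keep {P = ¬_ ∘ P} zs⊆ hz)
      (r₂ zs (≤-trans (m≤n⊔m _ _) (≤-reflexive (sym eq))))

  ramsey : ∀ t p q {P : List X → Set} → (∀ T → Dec (P T)) →
    ∀ xs → ramseyNumber t p q ≤ length xs → Ramsey P t p q xs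
  -- The only list of length 0 is `[]`, so its colour settles every sublist.
  ramsey zero p q {P} P? xs len with P? []
  ... | yes p[] = inj₁ (take p xs , take-⊆ p xs , take-length xs (m⊔n≤o⇒m≤o p q len) ,
                        λ { {[]} _ _ → p[] })
  ... | no ¬p[] = inj₂ (take q xs , take-⊆ q xs , take-length xs (m⊔n≤o⇒n≤o p q len) ,
                        λ { {[]} _ _ → ¬p[] })
  ramsey (suc t) zero    q       P? xs len = inj₁ ([] , minimum xs , refl , λ { [] () })
  ramsey (suc t) (suc p) zero    P? xs len = inj₂ ([] , minimum xs , refl , λ { [] () })
  ramsey (suc t) (suc p) (suc q) {P} P? (x ∷ xs) (s≤s len) = ramsey-∷ {P = P}
    (ramsey t _ _ (P? ∘ (x ∷_)) xs len)
    (ramsey (suc t) p (suc q) P?)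
    (ramsey (suc t) (suc p) q P?)

  iteratedRamseyNumber : ℕ → ℕ → ℕ → ℕ
  iteratedRamseyNumber t a zero    = a
  iteratedRamseyNumber t a (suc D) = ramseyNumber t m m
    where m = iteratedRamseyNumber t a D

  IteratedRamsey : (ℕ → List X → Set) → ℕ → ℕ → ℕ → List X → Set
  IteratedRamsey P t a D xs = ∃ λ ys → ys ⊆ xs × length ys ≡ a ×
    (∀ h → h < D → Homogeneous (P h) t ys ⊎ Homogeneous (¬_ ∘ P h) t ys)

  -- One application of Ramsey's theorem per colouring, each inside the list found before;
  -- homogeneity passes to sublists.
  iteratedRamsey : ∀ t a D {P : ℕ → List X → Set} → (∀ h T → Dec (P h T)) →
    ∀ xs → iteratedRamseyNumber t a D ≤ length xs → IteratedRamsey P t a D xs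
  iteratedRamsey t a zero P? xs len = take a xs , take-⊆ a xs , take-length xs len , λ _ ()
  iteratedRamsey t a (suc D) {P} P? xs len =
    Sum.[ (λ (zs , zs⊆ , eq , hz) → refine zs⊆ (inj₁ hz) (rec zs eq))
        , (λ (zs , zs⊆ , eq , hz) → refine zs⊆ (inj₂ hz) (rec zs eq)) ]′
      (ramsey t _ _ (P? D) xs len)
    where
    rec : ∀ zs → length zs ≡ iteratedRamseyNumber t a D → IteratedRamsey P t a D zs
    rec zs eq = iteratedRamsey t a D P? zs (≤-reflexive (sym eq))
    refine : ∀ {zs} → zs ⊆ xs → Homogeneous (P D) t zs ⊎ Homogeneous (¬_ ∘ P D) t zs →
      IteratedRamsey P t a D zs → IteratedRamsey P t a (suc D) xs
    refine zs⊆ hz (ys , ys⊆ , len , hy) = ys , ⊆-trans ys⊆ zs⊆ , len , λ h h<1+D →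
      Sum.[ hy h
          , (λ { refl → Sum.map (λ hP {_} T⊆ → hP (⊆-trans T⊆ ys⊆))
                                (λ hP {_} T⊆ → hP (⊆-trans T⊆ ys⊆)) hz }) ]′
        (m<1+n⇒m<n∨m≡n h<1+D)

  -- Finite sums

  ∑ : ℕ → (ℕ → ℕ) → ℕ
  ∑ zero    f = 0
  ∑ (suc n) f = f 0 + ∑ n (f ∘ suc)

  ∑-mono : ∀ n {f g : ℕ → ℕ} → (∀ i → i < n → f i ≤ g i) → ∑ n f ≤ ∑ n g
  ∑-mono zero    f≤g = z≤n
  ∑-mono (suc n) f≤g = +-mono-≤ (f≤g 0 z<s) (∑-mono n λ i i<n → f≤g (suc i) (s<s i<n))

  ∑-cong : ∀ n {f g : ℕ → ℕ} → f ≗ g → ∑ n f ≡ ∑ n g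
  ∑-cong zero    f≗g = refl
  ∑-cong (suc n) f≗g = cong₂ _+_ (f≗g 0) (∑-cong n (f≗g ∘ suc))

  ∑-const : ∀ n c → ∑ n (λ _ → c) ≡ n * c
  ∑-const zero    c = refl
  ∑-const (suc n) c = cong (c +_) (∑-const n c)

  +-interchange : ∀ a b c d → a + b + (c + d) ≡ a + c + (b + d)
  +-interchange = solve-∀

  ∑-+ : ∀ n (f g : ℕ → ℕ) → ∑ n (λ i → f i + g i) ≡ ∑ n f + ∑ n g
  ∑-+ zero    f g = refl
  ∑-+ (suc n) f g = trans (cong (f 0 + g 0 +_) (∑-+ n (f ∘ suc) (g ∘ suc)))
    (+-interchange (f 0) (g 0) (∑ n (f ∘ suc)) (∑ n (g ∘ suc)))

  ∑-*ˡ : ∀ n c (f : ℕ → ℕ) → ∑ n (λ i → c * f i) ≡ c * ∑ n f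
  ∑-*ˡ zero    c f = sym (*-zeroʳ c)
  ∑-*ˡ (suc n) c f = trans (cong (c * f 0 +_) (∑-*ˡ n c (f ∘ suc))) (sym (*-distribˡ-+ c (f 0) _))

  ∑-++ : ∀ m n (f : ℕ → ℕ) → ∑ (m + n) f ≡ ∑ m f + ∑ n (f ∘ (m +_))
  ∑-++ zero    n f = refl
  ∑-++ (suc m) n f = trans (cong (f 0 +_) (∑-++ m n (f ∘ suc))) (sym (+-assoc (f 0) _ _))

  ∑-blocks : ∀ B m {c} (f : ℕ → ℕ) → (∀ o → ∑ m (f ∘ (o +_)) ≤ c) → ∑ (B * m) f ≤ B * c
  ∑-blocks zero    m f f≤ = z≤n
  ∑-blocks (suc B) m {c} f f≤ = ≤-trans (≤-reflexive (∑-++ m (B * m) f))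
    (+-mono-≤ (f≤ 0) (∑-blocks B m (f ∘ (m +_)) λ o →
      ≤-trans (≤-reflexive (∑-cong m λ i → cong f (sym (+-assoc m o i)))) (f≤ (m + o))))

  ∑-extend : ∀ {m n} {g : ℕ → ℕ} → m ≤ n → ∑ m g ≤ ∑ n g
  ∑-extend z≤n     = z≤n
  ∑-extend (s≤s p) = +-monoʳ-≤ _ (∑-extend p)

  -- The sum of `v` starts at 0 rather than at `a`: the overcount is harmless and leaves a range
  -- that `∑-blocks` can handle.
  ∑-split : ∀ {L L′} a {f u v : ℕ → ℕ} → L ≤ L′ →
    (∀ i → i < a → f i ≤ u i) → (∀ i → a ≤ i → i < L′ → f i ≤ v i) →
    ∑ L f ≤ ∑ a u + ∑ L′ v
  ∑-split {L} {L′} zero L≤L′ f≤u f≤v =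
    ≤-trans (∑-mono L λ i i<L → f≤v i z≤n (<-≤-trans i<L L≤L′)) (∑-extend L≤L′)
  ∑-split (suc a) {f} {u} {v} z≤n f≤u f≤v = z≤n
  ∑-split {suc L} {suc L′} (suc a) {f} {u} {v} (s≤s L≤L′) f≤u f≤v = begin
    f 0 + ∑ L (f ∘ suc)
      ≤⟨ +-mono-≤ (f≤u 0 z<s) (∑-split a L≤L′ (λ i i<a → f≤u (suc i) (s<s i<a))
           (λ i a≤i i<L′ → f≤v (suc i) (s≤s a≤i) (s<s i<L′))) ⟩
    u 0 + (∑ a (u ∘ suc) + ∑ L′ (v ∘ suc))
      ≡⟨ +-assoc (u 0) _ _ ⟨
    u 0 + ∑ a (u ∘ suc) + ∑ L′ (v ∘ suc)
      ≤⟨ +-monoʳ-≤ (u 0 + ∑ a (u ∘ suc)) (m≤n+m _ (v 0)) ⟩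
    u 0 + ∑ a (u ∘ suc) + (v 0 + ∑ L′ (v ∘ suc)) ∎
    where open ≤-Reasoning

  𝟙 : {P : Set} → Dec P → ℕ
  𝟙 (yes _) = 1
  𝟙 (no _)  = 0

  𝟙-mono : {P Q : Set} (P? : Dec P) (Q? : Dec Q) → (P → Q) → 𝟙 P? ≤ 𝟙 Q?
  𝟙-mono (no _)  _        _   = z≤n
  𝟙-mono (yes _) (yes _)  _   = ≤-refl
  𝟙-mono (yes p) (no ¬q) P→Q = ⊥-elim (¬q (P→Q p))

  𝟙-no : {P : Set} (P? : Dec P) → ¬ P → 𝟙 P? ≡ 0
  𝟙-no (yes p) ¬p = ⊥-elim (¬p p)
  𝟙-no (no _)  _  = refl

  𝟙-yes : {P : Set} (P? : Dec P) → P → 𝟙 P? ≡ 1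
  𝟙-yes (yes _) _ = refl
  𝟙-yes (no ¬p) p = ⊥-elim (¬p p)

  -- Levels of distance

  module Levels (B : ℕ) .{{_ : NonZero B}} where

    AtLevel : ℕ → ℕ → ℕ → Set
    AtLevel h r x = x + B ^ h ≤ r × r < x + B ^ suc h

    AtLevel⇒< : ∀ {h r x} → AtLevel h r x → x < r
    AtLevel⇒< {h} {r} {x} (lo , _) = <-≤-trans (m<m+n x (m^n>0 B h)) lo

    -- Compare through `r`: `x + B ^ h ≤ r < y + B ^ suc g ≤ y + B ^ h`.
    AtLevel-antitone : ∀ {g h r x y} → g < h → AtLevel h r x → AtLevel g r y → x < y
    AtLevel-antitone {g} {h} {r} {x} {y} g<h (lo , _) (_ , hi) = +-cancelʳ-< (B ^ h) x y
      (≤-<-trans lo (<-≤-trans hi (+-monoʳ-≤ y (^-monoʳ-≤ B g<h))))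

    -- The bound `x < r` turns the decision into a finite search.
    Good : (ℕ → Set) → ℕ → ℕ → Set
    Good S r h = ∃ λ x → x < r × S x × AtLevel h r x

    module _ {S : ℕ → Set} (S? : ∀ x → Dec (S x)) where

      good? : ∀ r h → Dec (Good S r h)
      good? r h = anyUpTo? (λ x → S? x ×-dec (x + B ^ h ≤? r) ×-dec (r <? x + B ^ suc h)) r

      goodLevels : ℕ → ℕ → ℕ
      goodLevels r zero    = 0
      goodLevels r (suc D) = 𝟙 (good? r D) + goodLevels r D

      Bad : ℕ → ℕ → ℕ → Set
      Bad D k r = S r × goodLevels r D < k

      bad? : ∀ D k r → Dec (Bad D k r)
      bad? D k r = S? r ×-dec (goodLevels r D <? k)

      bad : ℕ → ℕ → ℕ → ℕ
      bad D k r = 𝟙 (bad? D k r)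

      -- Elements outside `S` are never bad, so the interval can be shortened from the left until it
      -- starts in `S`.
      ∑-bad-skip : ∀ D k {c} L o →
        (∀ m L′ → S m → L′ ≤ L → ∑ L′ (λ i → bad D k (m + i)) ≤ c) →
        ∑ L (λ i → bad D k (o + i)) ≤ c
      ∑-bad-skip D k zero o h = z≤n
      ∑-bad-skip D k {c} (suc L) o h with S? o
      ... | yes So = h o (suc L) So ≤-refl
      ... | no ¬So = begin
        bad D k (o + 0) + ∑ L (λ i → bad D k (o + suc i))
          ≡⟨ cong₂ _+_ (𝟙-no (bad? D k (o + 0)) λ (So , _) → ¬So (subst S (+-identityʳ o) So))
               (∑-cong L λ i → cong (bad D k) (+-suc o i)) ⟩
        ∑ L (λ i → bad D k (suc o + i))
          ≤⟨ ∑-bad-skip D k L (suc o) (λ m L′ Sm L′≤L → h m L′ Sm (m≤n⇒m≤1+n L′≤L)) ⟩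
        c ∎
        where open ≤-Reasoning

      -- In an interval of length B ^ (1 + D), every element of S at distance
      -- at least B ^ D from the least one is good at level D.
      ∑-bad≤ : ∀ D k o → ∑ (B ^ D) (λ i → bad D k (o + i)) ≤ 2 ^ D * B ^ k
      ∑-bad≤ zero k o = begin
        bad 0 k (o + 0) + 0 ≡⟨ +-identityʳ _ ⟩
        bad 0 k (o + 0)     ≤⟨ 𝟙≤1 (bad? 0 k (o + 0)) ⟩
        1                   ≤⟨ m^n>0 B k ⟩
        B ^ k               ≡⟨ *-identityˡ _ ⟨
        1 * B ^ k           ∎
        where
        open ≤-Reasoning
        𝟙≤1 : {P : Set} (P? : Dec P) → 𝟙 P? ≤ 1
        𝟙≤1 (yes _) = ≤-refl
        𝟙≤1 (no _)  = z≤n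
      ∑-bad≤ (suc D) zero o = begin
        ∑ (B ^ suc D) (λ i → bad (suc D) 0 (o + i))
          ≡⟨ ∑-cong (B ^ suc D) (λ i → 𝟙-no (bad? (suc D) 0 (o + i)) λ ()) ⟩
        ∑ (B ^ suc D) (λ _ → 0)  ≡⟨ ∑-const (B ^ suc D) 0 ⟩
        B ^ suc D * 0            ≡⟨ *-zeroʳ (B ^ suc D) ⟩
        0                        ≤⟨ z≤n ⟩
        2 ^ suc D * B ^ 0        ∎
        where open ≤-Reasoning
      ∑-bad≤ (suc D) (suc k) o = ∑-bad-skip (suc D) (suc k) (B ^ suc D) o λ m L′ Sm L′≤L → begin
        ∑ L′ (λ i → bad (suc D) (suc k) (m + i))
          -- Elements close to `m` are treated by dropping level `D`. For the others `m` witnesses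
          -- level `D`, so `k` falls by one, and `B` blocks of length `B ^ D` cover them. Both parts
          -- get the same bound, hence a factor 2 per level.
          ≤⟨ ∑-split (B ^ D) L′≤L (near m) (far m Sm) ⟩
        ∑ (B ^ D) (λ i → bad D (suc k) (m + i)) + ∑ (B * B ^ D) (λ i → bad D k (m + i))
          ≤⟨ +-mono-≤ (∑-bad≤ D (suc k) m) (∑-blocks B (B ^ D) _ (block m)) ⟩
        2 ^ D * B ^ suc k + B * (2 ^ D * B ^ k)
          ≡⟨ double (2 ^ D) B (B ^ k) ⟩
        2 ^ suc D * B ^ suc k ∎
        where
        open ≤-Reasoning
        double : ∀ a b c → a * (b * c) + b * (a * c) ≡ (2 * a) * (b * c)
        double = solve-∀
        near : ∀ m i → i < B ^ D → bad (suc D) (suc k) (m + i) ≤ bad D (suc k) (m + i)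
        near m i _ = 𝟙-mono (bad? (suc D) (suc k) (m + i)) (bad? D (suc k) (m + i))
          λ (Sr , few) → Sr , ≤-<-trans (m≤n+m _ (𝟙 (good? (m + i) D))) few
        far : ∀ m → S m → ∀ i → B ^ D ≤ i → i < B ^ suc D →
          bad (suc D) (suc k) (m + i) ≤ bad D k (m + i)
        far m Sm i lo hi = 𝟙-mono (bad? (suc D) (suc k) (m + i)) (bad? D k (m + i))
          λ (Sr , few) → Sr , s<s⁻¹ (subst (λ z → z + goodLevels (m + i) D < suc k)
            (𝟙-yes (good? (m + i) D) (m , AtLevel⇒< {D} level , Sm , level)) few)
          where
          level : AtLevel D (m + i) m
          level = +-monoʳ-≤ m lo , +-monoʳ-< m hi
        block : ∀ m o → ∑ (B ^ D) (λ i → bad D k (m + (o + i))) ≤ 2 ^ D * B ^ k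
        block m o = ≤-trans
          (≤-reflexive (∑-cong (B ^ D) λ i → cong (bad D k) (sym (+-assoc m o i))))
          (∑-bad≤ D k (m + o))

  -- Supersaturation

  ∑ₗ : List X → (X → ℕ) → ℕ
  ∑ₗ xs f = sum (map f xs)

  ∑ₗ-+ : ∀ (xs : List X) (f g : X → ℕ) → ∑ₗ xs (λ x → f x + g x) ≡ ∑ₗ xs f + ∑ₗ xs g
  ∑ₗ-+ []       f g = refl
  ∑ₗ-+ (x ∷ xs) f g = trans (cong (f x + g x +_) (∑ₗ-+ xs f g))
    (+-interchange (f x) (g x) (∑ₗ xs f) (∑ₗ xs g))

  ∑ₗ-mono : ∀ (xs : List X) {f g : X → ℕ} → (∀ x → f x ≤ g x) → ∑ₗ xs f ≤ ∑ₗ xs g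
  ∑ₗ-mono []       f≤g = z≤n
  ∑ₗ-mono (x ∷ xs) f≤g = +-mono-≤ (f≤g x) (∑ₗ-mono xs f≤g)

  ∑ₗ-*ˡ : ∀ (xs : List X) c (f : X → ℕ) → ∑ₗ xs (λ x → c * f x) ≡ c * ∑ₗ xs f
  ∑ₗ-*ˡ []       c f = sym (*-zeroʳ c)
  ∑ₗ-*ˡ (x ∷ xs) c f = trans (cong (c * f x +_) (∑ₗ-*ˡ xs c f)) (sym (*-distribˡ-+ c (f x) _))

  ∑ₗ-const : ∀ (xs : List X) c → ∑ₗ xs (λ _ → c) ≡ length xs * c
  ∑ₗ-const []       c = refl
  ∑ₗ-const (x ∷ xs) c = cong (c +_) (∑ₗ-const xs c)

  -- Membership is phrased as a one-element sublist so that it can be concatenated with a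
  -- transversal of the later blocks.
  ∑ₗ-≥ : ∀ (xs : List X) {c} {f : X → ℕ} → (∀ {x} → x ∷ [] ⊆ xs → c ≤ f x) →
    length xs * c ≤ ∑ₗ xs f
  ∑ₗ-≥ []       c≤f = z≤n
  ∑ₗ-≥ (x ∷ xs) c≤f = +-mono-≤ (c≤f (refl ∷ minimum xs)) (∑ₗ-≥ xs λ y⊆ → c≤f (x ∷ʳ y⊆))

  ∑-sublists : ℕ → List X → (List X → ℕ) → ℕ
  ∑-sublists zero    xs       β = β []
  ∑-sublists (suc t) []       β = 0
  ∑-sublists (suc t) (x ∷ xs) β = ∑-sublists t xs (β ∘ (x ∷_)) + ∑-sublists (suc t) xs β

  ∑-sublists-⊆ : ∀ t {xs ys : List X} (β : List X → ℕ) → xs ⊆ ys →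
    ∑-sublists t xs β ≤ ∑-sublists t ys β
  ∑-sublists-⊆ zero    β xs⊆ys         = ≤-refl
  ∑-sublists-⊆ (suc t) β []            = z≤n
  ∑-sublists-⊆ (suc t) β (y ∷ʳ xs⊆ys)  = ≤-trans (∑-sublists-⊆ (suc t) β xs⊆ys) (m≤n+m _ _)
  ∑-sublists-⊆ (suc t) β (refl ∷ xs⊆ys) =
    +-mono-≤ (∑-sublists-⊆ t _ xs⊆ys) (∑-sublists-⊆ (suc t) β xs⊆ys)

  -- Pascal's rule with a crude estimate: `n ^ t + n ^ suc t = suc n * n ^ t ≤ suc n ^ suc t`.
  ∑-sublists-≤ : ∀ t (xs : List X) {c} {β : List X → ℕ} → (∀ T → β T ≤ c) →
    ∑-sublists t xs β ≤ length xs ^ t * c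
  ∑-sublists-≤ zero    xs       {c} β≤c = ≤-trans (β≤c []) (≤-reflexive (sym (*-identityˡ c)))
  ∑-sublists-≤ (suc t) []           β≤c = z≤n
  ∑-sublists-≤ (suc t) (x ∷ xs) {c} {β} β≤c = begin
    ∑-sublists t xs (β ∘ (x ∷_)) + ∑-sublists (suc t) xs β
      ≤⟨ +-mono-≤ (∑-sublists-≤ t xs (β≤c ∘ (x ∷_))) (∑-sublists-≤ (suc t) xs β≤c) ⟩
    n ^ t * c + n ^ suc t * c
      ≡⟨ *-distribʳ-+ c (n ^ t) (n ^ suc t) ⟨
    suc n * n ^ t * c
      ≤⟨ *-monoˡ-≤ c (*-monoʳ-≤ (suc n) (^-monoˡ-≤ t (n≤1+n n))) ⟩
    suc n ^ suc t * c ∎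
    where
    open ≤-Reasoning
    n = length xs

  ∑-sublists-≥ : ∀ t (xs : List X) {β : List X → ℕ} {T} →
    T ⊆ xs → length T ≡ t → β T ≤ ∑-sublists t xs β
  ∑-sublists-≥ zero    xs       {T = []}    T⊆          _   = ≤-refl
  ∑-sublists-≥ (suc t) (x ∷ xs)             (_ ∷ʳ T⊆)   len =
    ≤-trans (∑-sublists-≥ (suc t) xs T⊆ len) (m≤n+m _ _)
  ∑-sublists-≥ (suc t) (x ∷ xs) {β}         (refl ∷ T⊆) len =
    ≤-trans (∑-sublists-≥ t xs {β ∘ (x ∷_)} T⊆ (suc-injective len)) (m≤m+n _ _)

  ∑-∑-sublists : ∀ n t (xs : List X) (β : ℕ → List X → ℕ) →
    ∑ n (λ r → ∑-sublists t xs (β r)) ≡ ∑-sublists t xs (λ T → ∑ n (λ r → β r T))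
  ∑-∑-sublists n zero    xs       β = refl
  ∑-∑-sublists n (suc t) []       β = trans (∑-const n 0) (*-zeroʳ n)
  ∑-∑-sublists n (suc t) (x ∷ xs) β = trans (∑-+ n _ _)
    (cong₂ _+_ (∑-∑-sublists n t xs λ r → β r ∘ (x ∷_)) (∑-∑-sublists n (suc t) xs β))

  -- Sums over the lists that contain one element from each of the first R
  -- blocks of s consecutive elements.
  ∑-transversals : ℕ → ℕ → List X → (List X → ℕ) → ℕ
  ∑-transversals s zero    xs γ = γ []
  ∑-transversals s (suc R) xs γ =
    ∑ₗ (take s xs) λ x → ∑-transversals s R (drop s xs) (γ ∘ (x ∷_))

  ∑-transversals-+ : ∀ s R (xs : List X) (γ δ : List X → ℕ) →
    ∑-transversals s R xs (λ y → γ y + δ y) ≡ ∑-transversals s R xs γ + ∑-transversals s R xs δ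
  ∑-transversals-+ s zero    xs γ δ = refl
  ∑-transversals-+ s (suc R) xs γ δ = trans
    (cong sum (map-cong
      (λ x → ∑-transversals-+ s R (drop s xs) (γ ∘ (x ∷_)) (δ ∘ (x ∷_))) (take s xs)))
    (∑ₗ-+ (take s xs) _ _)

  -- The length makes all `R` blocks full, so there are `s ^ R` transversals, each a sublist of
  -- length `R`.
  ∑-transversals-≥ : ∀ s R (xs : List X) {γ : List X → ℕ} → R * s ≤ length xs →
    (∀ {y} → y ⊆ xs → length y ≡ R → 1 ≤ γ y) → s ^ R ≤ ∑-transversals s R xs γ
  ∑-transversals-≥ s zero    xs     len γ≥1 = γ≥1 (minimum xs) refl
  ∑-transversals-≥ s (suc R) xs {γ} len γ≥1 = begin
    s * s ^ R                        ≡⟨ cong (_* s ^ R) (take-length xs (m+n≤o⇒m≤o s len)) ⟨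
    length (take s xs) * s ^ R       ≤⟨ ∑ₗ-≥ (take s xs) (λ x⊆ → ∑-transversals-≥ s R (drop s xs) rest
                                          λ y⊆ eq → γ≥1 (join x⊆ y⊆) (cong suc eq)) ⟩
    ∑-transversals s (suc R) xs γ    ∎
    where
    open ≤-Reasoning
    rest : R * s ≤ length (drop s xs)
    rest = begin
      R * s               ≡⟨ m+n∸m≡n s (R * s) ⟨
      s + R * s ∸ s       ≤⟨ ∸-monoˡ-≤ s len ⟩
      length xs ∸ s       ≡⟨ length-drop s xs ⟨
      length (drop s xs)  ∎
    join : ∀ {x y} → x ∷ [] ⊆ take s xs → y ⊆ drop s xs → x ∷ y ⊆ xs
    join x⊆ y⊆ = subst (_ ⊆_) (take++drop≡id s xs) (++⁺ x⊆ y⊆)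

  -- The left side counts the sublists with at most one element in `ys`; within a transversal whose
  -- first block is `ys`, no others occur.
  ∑-sublists-++ : ∀ t (ys zs : List X) (β : List X → ℕ) →
    ∑ₗ ys (λ x → ∑-sublists t zs (β ∘ (x ∷_))) + ∑-sublists (suc t) zs β ≤
    ∑-sublists (suc t) (ys ++ zs) β
  ∑-sublists-++ t []       zs β = ≤-refl
  ∑-sublists-++ t (y ∷ ys) zs β = ≤-trans (≤-reflexive (+-assoc (∑-sublists t zs _) _ _))
    (+-mono-≤ (∑-sublists-⊆ t _ (++⁺ˡ ys ⊆-refl)) (∑-sublists-++ t ys zs β))

  -- A t-list that meets t distinct blocks is contained in s ^ (R ∸ t) transversals.
  ∑-transversals-∑-sublists : ∀ s R t (xs : List X) (β : List X → ℕ) →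
    s ^ t * ∑-transversals s R xs (λ y → ∑-sublists t y β) ≤ s ^ R * ∑-sublists t xs β
  ∑-transversals-∑-sublists s zero zero xs β = ≤-refl
  ∑-transversals-∑-sublists s zero (suc t) xs β =
    ≤-trans (≤-reflexive (*-zeroʳ (s ^ suc t))) z≤n
  ∑-transversals-∑-sublists s (suc R) zero xs β = begin
    1 * ∑ₗ hd (λ _ → ∑-transversals s R ys (λ _ → β []))   ≡⟨ *-identityˡ _ ⟩
    ∑ₗ hd (λ _ → ∑-transversals s R ys (λ _ → β []))       ≡⟨ ∑ₗ-const hd _ ⟩
    length hd * ∑-transversals s R ys (λ _ → β [])
      ≤⟨ *-mono-≤ (≤-trans (≤-reflexive (length-take s xs)) (m⊓n≤m s _))
           (≤-trans (≤-reflexive (sym (*-identityˡ _))) (∑-transversals-∑-sublists s R zero ys β)) ⟩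
    s * (s ^ R * β [])                                     ≡⟨ *-assoc s (s ^ R) (β []) ⟨
    s * s ^ R * β []                                       ∎
    where
    open ≤-Reasoning
    hd = take s xs
    ys = drop s xs
  ∑-transversals-∑-sublists s (suc R) (suc t) xs β = begin
    s * s ^ t * ∑ₗ hd (λ x → TR (λ y → ∑-sublists t y (β ∘ (x ∷_)) + ∑-sublists (suc t) y β))
      -- A sublist of `x ∷ y` either takes `x` or lies in `y`; the second contribution, `N`, is the
      -- same for every `x` of the block.
      ≡⟨ cong (λ z → s * s ^ t * sum z) (map-cong (λ x → ∑-transversals-+ s R ys _ _) hd) ⟩
    s * s ^ t * ∑ₗ hd (λ x → TR (λ y → ∑-sublists t y (β ∘ (x ∷_))) + N)
      ≡⟨ cong (s * s ^ t *_) (∑ₗ-+ hd _ (λ _ → N)) ⟩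
    s * s ^ t * (∑ₗ hd (λ x → TR (λ y → ∑-sublists t y (β ∘ (x ∷_)))) + ∑ₗ hd (λ _ → N))
      ≡⟨ cong (λ z → s * s ^ t * (∑ₗ hd (λ x → TR (λ y → ∑-sublists t y (β ∘ (x ∷_)))) + z))
           (∑ₗ-const hd N) ⟩
    s * s ^ t * (∑ₗ hd (λ x → TR (λ y → ∑-sublists t y (β ∘ (x ∷_)))) + length hd * N)
      -- If the list runs out, the block has fewer than `s` elements.
      ≤⟨ *-monoʳ-≤ (s * s ^ t) (+-monoʳ-≤ _
           (*-monoˡ-≤ N (≤-trans (≤-reflexive (length-take s xs)) (m⊓n≤m s _)))) ⟩
    s * s ^ t * (∑ₗ hd (λ x → TR (λ y → ∑-sublists t y (β ∘ (x ∷_)))) + s * N)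
      ≡⟨ expand s (s ^ t) _ N ⟩
    s * (s ^ t * ∑ₗ hd (λ x → TR (λ y → ∑-sublists t y (β ∘ (x ∷_)))) + s * s ^ t * N)
      ≡⟨ cong (λ z → s * (z + s * s ^ t * N)) (sym (∑ₗ-*ˡ hd (s ^ t) _)) ⟩
    s * (∑ₗ hd (λ x → s ^ t * TR (λ y → ∑-sublists t y (β ∘ (x ∷_)))) + s * s ^ t * N)
      ≤⟨ *-monoʳ-≤ s (+-mono-≤
           (∑ₗ-mono hd λ x → ∑-transversals-∑-sublists s R t ys (β ∘ (x ∷_)))
           (∑-transversals-∑-sublists s R (suc t) ys β)) ⟩
    s * (∑ₗ hd (λ x → s ^ R * ∑-sublists t ys (β ∘ (x ∷_))) + s ^ R * ∑-sublists (suc t) ys β)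
      ≡⟨ cong (λ z → s * (z + s ^ R * ∑-sublists (suc t) ys β)) (∑ₗ-*ˡ hd (s ^ R) _) ⟩
    s * (s ^ R * ∑ₗ hd (λ x → ∑-sublists t ys (β ∘ (x ∷_))) + s ^ R * ∑-sublists (suc t) ys β)
      ≡⟨ collect s (s ^ R) _ _ ⟩
    s * s ^ R * (∑ₗ hd (λ x → ∑-sublists t ys (β ∘ (x ∷_))) + ∑-sublists (suc t) ys β)
      ≤⟨ *-monoʳ-≤ (s * s ^ R) (∑-sublists-++ t hd ys β) ⟩
    s * s ^ R * ∑-sublists (suc t) (hd ++ ys) β
      ≡⟨ cong (λ z → s * s ^ R * ∑-sublists (suc t) z β) (take++drop≡id s xs) ⟩
    s * s ^ R * ∑-sublists (suc t) xs β ∎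
    where
    open ≤-Reasoning
    hd = take s xs
    ys = drop s xs
    TR = ∑-transversals s R ys
    N = TR (λ y → ∑-sublists (suc t) y β)
    expand : ∀ s a b c → s * a * (b + s * c) ≡ s * (a * b + s * a * c)
    expand = solve-∀
    collect : ∀ s a b c → s * (a * b + a * c) ≡ s * a * (b + c)
    collect = solve-∀

  -- Average over transversals: each of the `s ^ R` transversals contributes at least 1, and
  -- `∑-transversals-∑-sublists` limits how often a single sublist is counted. For fixed `R` and `s`
  -- about `length xs / R`, this is a positive proportion of all sublists.
  supersaturation : ∀ R t (xs : List X) (β : List X → ℕ) →
    (∀ {y} → y ⊆ xs → length y ≡ R → 1 ≤ ∑-sublists (suc t) y β) →
    ∀ s → R * s ≤ length xs → s ^ suc t ≤ ∑-sublists (suc t) xs β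
  supersaturation R t xs β hit zero      _   = z≤n
  supersaturation R t xs β hit s@(suc _) len = *-cancelˡ-≤ (s ^ R) {{m^n≢0 s R}} (begin
    s ^ R * s ^ suc t           ≡⟨ *-comm (s ^ R) (s ^ suc t) ⟩
    s ^ suc t * s ^ R           ≤⟨ *-monoʳ-≤ (s ^ suc t) (∑-transversals-≥ s R xs len hit) ⟩
    s ^ suc t * ∑-transversals s R xs (λ y → ∑-sublists (suc t) y β)
                                ≤⟨ ∑-transversals-∑-sublists s R (suc t) xs β ⟩
    s ^ R * ∑-sublists (suc t) xs β ∎)
    where open ≤-Reasoning

  -- Embedding

  module Star (B : ℕ) .{{_ : NonZero B}} {X : Set} {E : ℕ → X → Set}
    (E? : ∀ r x → Dec (E r x)) where

    open Levels B

    Common : List X → ℕ → Set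
    Common T r = All (E r) T

    common? : ∀ T r → Dec (Common T r)
    common? T r = All.all? (E? r) T

    -- Levels are collected from the top down, since by `AtLevel-antitone` decreasing levels yield
    -- increasing rows.
    decreasingLevels : ∀ {S : ℕ → Set} (S? : ∀ x → Dec (S x)) k D r → k ≤ goodLevels S? r D →
      ∃ λ (h : Fin k → ℕ) → (∀ {i j} → i Fin.< j → h j < h i) × (∀ i → h i < D × Good S r (h i))
    decreasingLevels S? zero    D       r _    = (λ ()) , (λ { {()} }) , λ ()
    decreasingLevels S? (suc k) (suc D) r many with good? S? r D
    ... | no _ with decreasingLevels S? (suc k) D r many
    ...   | h , h↓ , hg = h , h↓ , λ i → m<n⇒m<1+n (proj₁ (hg i)) , proj₂ (hg i)
    decreasingLevels {S} S? (suc k) (suc D) r (s≤s many) | yes g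
      with decreasingLevels S? k D r many
    ...   | h , h↓ , hg = h′ , h′↓ , h′g
      where
      h′ : Fin (suc k) → ℕ
      h′ zero    = D
      h′ (suc i) = h i
      h′↓ : ∀ {i j} → i Fin.< j → h′ j < h′ i
      h′↓ {zero}  {suc j} _         = proj₁ (hg j)
      h′↓ {suc i} {suc j} (s≤s i<j) = h↓ i<j
      h′g : ∀ i → h′ i < suc D × Good S r (h′ i)
      h′g zero    = n<1+n D , g
      h′g (suc i) = m<n⇒m<1+n (proj₁ (hg i)) , proj₂ (hg i)

    -- The levels are read off from the single list `take t ys`. Homogeneity carries them over to
    -- every other `T i`, so row `i` may use its own columns at the common level `h i`.
    orderedRows : ∀ D k t {a} → t ≤ a → ∀ r (xs : List X) → iteratedRamseyNumber t a D ≤ length xs →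
      All (E r) xs → (∀ {T} → T ⊆ xs → length T ≡ t → ¬ Bad (common? T) D k r) →
      ∃ λ ys → ys ⊆ xs × length ys ≡ a ×
        ((T : Fin k → List X) → (∀ i → T i ⊆ ys × length (T i) ≡ t) →
         ∃ λ (ρ : Fin k → ℕ) → (∀ {i j} → i Fin.< j → ρ i < ρ j) ×
           (∀ i → ρ i < r × Common (T i) (ρ i)))
    orderedRows D k t {a} t≤a r xs len star ¬bad
      with iteratedRamsey t a D {P = λ h T → Good (Common T) r h}
             (λ h T → good? (common? T) r h) xs len
    ... | ys , ys⊆ , refl , hom
      with decreasingLevels (common? (take t ys)) k D r
             -- `r` itself is adjacent to all of `take t ys`, so not being bad means having at least
             -- `k` good levels.
             (≮⇒≥ λ few → ¬bad T₀⊆ (take-length ys t≤a) (All-resp-⊆ T₀⊆ star , few))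
      where
      T₀⊆ : take t ys ⊆ xs
      T₀⊆ = ⊆-trans (take-⊆ t ys) ys⊆
    ... | h , h↓ , hg = ys , ys⊆ , refl , λ T T⊆ →
      (λ i → proj₁ (good T T⊆ i)) ,
      (λ {i} {j} i<j → AtLevel-antitone (h↓ i<j)
        (proj₂ (proj₂ (proj₂ (good T T⊆ i)))) (proj₂ (proj₂ (proj₂ (good T T⊆ j))))) ,
      λ i → proj₁ (proj₂ (good T T⊆ i)) , proj₁ (proj₂ (proj₂ (good T T⊆ i)))
      where
      good : (T : Fin k → List X) → (∀ i → T i ⊆ ys × length (T i) ≡ t) →
        ∀ i → Good (Common (T i)) r (h i)
      good T T⊆ i with hom (h i) (proj₁ (hg i))
      ... | inj₁ all-good = all-good (proj₁ (T⊆ i)) (proj₂ (T⊆ i))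
      -- A level that is good for `take t ys` cannot be homogeneously bad.
      ... | inj₂ all-bad  = contradiction (proj₂ (hg i)) (all-bad (take-⊆ t ys) (take-length ys t≤a))

  -- The elements of the list at the positions of the 1-entries, filled up to
  -- length t with further elements.
  select : ∀ {l} → Vec Bool l → ℕ → List X → List X
  select []          t       zs       = take t zs
  select (b ∷ v)     t       []       = []
  select (false ∷ v) t       (z ∷ zs) = select v t zs
  select (true ∷ v)  zero    (z ∷ zs) = []
  select (true ∷ v)  (suc t) (z ∷ zs) = z ∷ select v t zs

  select-⊆ : ∀ {l} (v : Vec Bool l) t (zs : List X) → select v t zs ⊆ zs
  select-⊆ []          t       zs       = take-⊆ t zs
  select-⊆ (b ∷ v)     t       []       = []
  select-⊆ (false ∷ v) t       (z ∷ zs) = z ∷ʳ select-⊆ v t zs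
  select-⊆ (true ∷ v)  zero    (z ∷ zs) = minimum _
  select-⊆ (true ∷ v)  (suc t) (z ∷ zs) = refl ∷ select-⊆ v t zs

  -- The `l` positions of `v` are passed first; up to `t` more elements must remain for filling up.
  length-select : ∀ {l} (v : Vec Bool l) t (zs : List X) → ones v ≤ t → l + t ≤ length zs →
    length (select v t zs) ≡ t
  length-select []          t       zs       _         len       = take-length zs len
  length-select (false ∷ v) t       (z ∷ zs) few       (s≤s len) = length-select v t zs few len
  length-select {l = suc l} (true ∷ v) (suc t) (z ∷ zs) (s≤s few) (s≤s len) =
    cong suc (length-select v t zs few (≤-trans (+-monoʳ-≤ l (n≤1+n t)) len))

  ∈-select : ∀ {l m} (v : Vec Bool l) t (zs : Vec X (l + m)) → ones v ≤ t →
    ∀ j → lookup v j ≡ true → lookup zs (j ↑ˡ m) ∈ select v t (toList zs)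
  ∈-select (true ∷ v)  (suc t) (z ∷ zs) (s≤s few) zero    refl = here refl
  ∈-select (true ∷ v)  (suc t) (z ∷ zs) (s≤s few) (suc j) vj   = there (∈-select v t zs few j vj)
  ∈-select (false ∷ v) t       (z ∷ zs) few       (suc j) vj   = ∈-select v t zs few j vj

  AllPairs-resp-⊆ : ∀ {R : X → X → Set} {xs ys} → xs ⊆ ys → AllPairs R ys → AllPairs R xs
  AllPairs-resp-⊆ []            []         = []
  AllPairs-resp-⊆ (_ ∷ʳ xs⊆)    (_ ∷ rys)  = AllPairs-resp-⊆ xs⊆ rys
  AllPairs-resp-⊆ (refl ∷ xs⊆)  (ry ∷ rys) = All-resp-⊆ xs⊆ ry ∷ AllPairs-resp-⊆ xs⊆ rys

  AllPairs-lookup : ∀ {R : X → X → Set} {m} (zs : Vec X m) → AllPairs R (toList zs) →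
    ∀ {i j} → i Fin.< j → R (lookup zs i) (lookup zs j)
  AllPairs-lookup {R = R} (z ∷ zs) (rz ∷ _) {zero} {suc j} _ = all-lookup zs rz j
    where
    all-lookup : ∀ {m} (ys : Vec _ m) → All (R z) (toList ys) → ∀ j → R z (lookup ys j)
    all-lookup (y ∷ ys) (py ∷ _)  zero    = py
    all-lookup (y ∷ ys) (_ ∷ pys) (suc j) = all-lookup ys pys j
  AllPairs-lookup (z ∷ zs) (_ ∷ rzs) {suc i} {suc j} (s≤s i<j) = AllPairs-lookup zs rzs i<j

  listToVec : ∀ {m} (xs : List X) → length xs ≡ m → ∃ λ (v : Vec X m) → toList v ≡ xs
  listToVec xs refl = fromList xs , toList∘fromList xs

  implies⇒≤ : ∀ {a b : Bool} → (a ≡ true → b ≡ true) → a Bool.≤ b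
  implies⇒≤ {false} {false} _ = Bool.b≤b
  implies⇒≤ {false} {true}  _ = Bool.f≤t
  implies⇒≤ {true}  {b}     h rewrite h refl = Bool.b≤b

  ones-≤-filter : ∀ {l} {P : X → Set} (P? : ∀ x → Dec (P x)) (v : Vec Bool l) (f : Fin l → X) →
    (∀ j → lookup v j ≡ true → P (f j)) → ones v ≤ length (filter P? (tabulate f))
  ones-≤-filter P? []          f h = z≤n
  ones-≤-filter P? (true ∷ v)  f h = ≤-trans (s≤s (ones-≤-filter P? v (f ∘ suc) (h ∘ suc)))
    (≤-reflexive (cong length (sym (filter-accept P? (h zero refl)))))
  ones-≤-filter P? (false ∷ v) f h with P? (f zero)
  ... | yes _ = m≤n⇒m≤1+n (ones-≤-filter P? v (f ∘ suc) (h ∘ suc))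
  ... | no _  = ones-≤-filter P? v (f ∘ suc) (h ∘ suc)

  sum-≤-∑ : ∀ {m} (v : Vec ℕ m) {g : ℕ → ℕ} → (∀ i → lookup v i ≤ g (toℕ i)) → Vec.sum v ≤ ∑ m g
  sum-≤-∑ []      v≤g = z≤n
  sum-≤-∑ (x ∷ v) v≤g = +-mono-≤ (v≤g zero) (sum-≤-∑ v (v≤g ∘ suc))

  -- Neighbourhoods of rows and the placement of a pattern in a matrix

  module Avoiding {n} (M : Matrix n n) where

    -- Rows are indexed by natural numbers to suit the arithmetic of levels; an index outside the
    -- matrix has no 1-entries.
    One : ℕ → Fin n → Set
    One r c = ∃ λ i → toℕ i ≡ r × entry M i c ≡ true

    one? : ∀ r c → Dec (One r c)
    one? r c = Fin.any? λ i → (toℕ i ≟ r) ×-dec (entry M i c Bool.≟ true)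

    neighbours : ℕ → List (Fin n)
    neighbours r = filter (one? r) (allFin n)

    weight≤∑ : weight M ≤ ∑ n (length ∘ neighbours)
    weight≤∑ = sum-≤-∑ (Vec.map ones M) λ i → ≤-trans
      (≤-reflexive (lookup-map i ones M))
      (ones-≤-filter (one? (toℕ i)) (row M i) id λ j eq → i , refl , eq)

    module _ {k l} (A : Matrix k l) (t : ℕ) (A≤t : ∀ i → ones (row A i) ≤ t)
      (B : ℕ) .{{_ : NonZero B}} (D : ℕ) where

      open Levels B
      open Star B one?

      -- Each row of `A` asks for a common neighbour of the columns of its 1-entries, padded to
      -- exactly `t` columns so that `orderedRows` applies.
      contains : ∀ r xs → r < n → xs ⊆ neighbours r →
        iteratedRamseyNumber t (l + t) D ≤ length xs →
        (∀ {T} → T ⊆ xs → length T ≡ t → ¬ Bad (common? T) D k r) → Contains M A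
      contains r xs r<n xs⊆ len ¬bad
        with orderedRows D k t (m≤n+m t l) r xs len
               (All-resp-⊆ xs⊆ (all-filter (one? r) (allFin n))) ¬bad
      ... | ys , ys⊆ , lenys , place with listToVec ys lenys
      ...   | zs , refl with place (λ i → select (row A i) t (toList zs)) (λ i →
                select-⊆ (row A i) t (toList zs) ,
                length-select (row A i) t (toList zs) (A≤t i) (≤-reflexive (sym lenys)))
      ...     | ρ , ρ↑ , common = rows , cols , rows↑ , cols↑ , A⊑
        where
        rows : Fin k → Fin n
        rows i = fromℕ< (<-trans (proj₁ (common i)) r<n)
        cols : Fin l → Fin n
        -- The columns of `A` go to the first `l` of the `l + t` columns; the last `t` serve as
        -- padding.
        cols j = lookup zs (j ↑ˡ t)
        rows↑ : StrictlyIncreasing rows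
        rows↑ i<j = subst₂ _<_ (sym (Fin.toℕ-fromℕ< _)) (sym (Fin.toℕ-fromℕ< _)) (ρ↑ i<j)
        cols↑ : StrictlyIncreasing cols
        cols↑ {i} {j} i<j = AllPairs-lookup zs
          (AllPairs-resp-⊆ (⊆-trans ys⊆ (⊆-trans xs⊆ (filter-⊆ (one? r) (allFin n))))
            (tabulate⁺-< id))
          (subst₂ _<_ (sym (Fin.toℕ-↑ˡ i t)) (sym (Fin.toℕ-↑ˡ j t)) i<j)
        A⊑ : A ⊑ submatrix M rows cols
        A⊑ i j = implies⇒≤ λ Aij → trans entry-submatrix (subst (λ p → entry M p (cols j) ≡ true)
          (Fin.toℕ-injective (trans (proj₁ (proj₂ (one Aij))) (sym (Fin.toℕ-fromℕ< _))))
          (proj₂ (proj₂ (one Aij))))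
          where
          one : lookup (row A i) j ≡ true → One (ρ i) (cols j)
          one Aij = All.lookup (proj₂ (common i)) (∈-select (row A i) t zs (A≤t i) j Aij)
          entry-submatrix : entry (submatrix M rows cols) i j ≡ entry M (rows i) (cols j)
          entry-submatrix = trans
            (cong (λ v → lookup v j)
              (lookup∘tabulate (λ p → Vec.tabulate λ q → entry M (rows p) (cols q)) i))
            (lookup∘tabulate (λ q → entry M (rows i) (cols q)) j)

    -- Double counting in a matrix that avoids the pattern, with `suc t` as the row bound

    module _ {k l} (A : Matrix k l) (t : ℕ) (A≤t : ∀ i → ones (row A i) ≤ suc t)
      (B : ℕ) .{{_ : NonZero B}} (D : ℕ) (n≤B^D : n ≤ B ^ D) (M∌A : ¬ Contains M A) where

      open Levels B
      open Star B one?

      -- The successor makes `R` nonzero, as a divisor must be.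
      R : ℕ
      R = suc (iteratedRamseyNumber (suc t) (l + suc t) D)

      β : ℕ → List (Fin n) → ℕ
      β r T = bad (common? T) D k r

      -- Count pairs of a row and a bad list of columns: by rows from below with `supersaturation`,
      -- by lists from above with `∑-bad≤`.
      ∑-power≤ : ∑ n (λ r → (length (neighbours r) / R) ^ suc t) ≤ n ^ suc t * (2 ^ D * B ^ k)
      ∑-power≤ = begin
        ∑ n (λ r → (length (neighbours r) / R) ^ suc t)
          ≤⟨ ∑-mono n (λ r r<n → supersaturation R t (neighbours r) (β r) (hit r r<n)
               (length (neighbours r) / R)
               (≤-trans (≤-reflexive (*-comm R (length (neighbours r) / R)))
                 (m/n*n≤m (length (neighbours r)) R))) ⟩
        ∑ n (λ r → ∑-sublists (suc t) (neighbours r) (β r))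
          ≤⟨ ∑-mono n (λ r _ → ∑-sublists-⊆ (suc t) (β r) (filter-⊆ (one? r) (allFin n))) ⟩
        ∑ n (λ r → ∑-sublists (suc t) (allFin n) (β r))
          ≡⟨ ∑-∑-sublists n (suc t) (allFin n) β ⟩
        ∑-sublists (suc t) (allFin n) (λ T → ∑ n (λ r → β r T))
          ≤⟨ ∑-sublists-≤ (suc t) (allFin n) (λ T →
               -- The rows are part of one interval of length `B ^ D`.
               ≤-trans (∑-extend n≤B^D) (∑-bad≤ (common? T) D k 0)) ⟩
        length (allFin n) ^ suc t * (2 ^ D * B ^ k)
          ≡⟨ cong (λ z → z ^ suc t * (2 ^ D * B ^ k)) (length-tabulate {n = n} id) ⟩
        n ^ suc t * (2 ^ D * B ^ k) ∎
        where
        open ≤-Reasoning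
        hit : ∀ r → r < n → ∀ {y} → y ⊆ neighbours r → length y ≡ R → 1 ≤ ∑-sublists (suc t) y (β r)
        -- If the sum were 0, no `suc t` columns of `y` would be bad, and `contains` would produce
        -- `A`.
        hit r r<n {y} y⊆ len = ≮⇒≥ λ none → M∌A (contains A (suc t) A≤t B D r y r<n y⊆
          (≤-trans (n≤1+n _) (≤-reflexive (sym len)))
          λ {T} T⊆ lenT isBad → 1+n≰n (≤-trans
            (≤-trans (≤-reflexive (sym (𝟙-yes (bad? (common? T) D k r) isBad)))
              (∑-sublists-≥ (suc t) y {β r} T⊆ lenT))
            (m<1+n⇒m≤n none)))

      -- Passes from a bound on the sum of powers to one on the sum itself, with `a` as the typical
      -- size of `s r`. Of the constant 3, one part pays for rounding in the division by `R` and two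
      -- come from `∑s≤`.
      weight≤ : ∀ a .{{_ : NonZero a}} → n ^ t * (2 ^ D * B ^ k) ≤ a ^ suc t →
        weight M ≤ 3 * R * (n * a)
      weight≤ a a-large = begin
        weight M                              ≤⟨ weight≤∑ ⟩
        ∑ n (λ r → length (neighbours r))     ≤⟨ ∑-mono n (λ r _ → length≤ r) ⟩
        ∑ n (λ r → R * suc (s r))             ≡⟨ ∑-*ˡ n R (λ r → suc (s r)) ⟩
        R * ∑ n (λ r → 1 + s r)               ≡⟨ cong (R *_) (∑-+ n (λ _ → 1) s) ⟩
        R * (∑ n (λ _ → 1) + ∑ n s)           ≡⟨ cong (λ z → R * (z + ∑ n s)) (∑-const n 1) ⟩
        R * (n * 1 + ∑ n s)                   ≤⟨ *-monoʳ-≤ R (+-mono-≤ (*-monoʳ-≤ n (>-nonZero⁻¹ a)) ∑s≤) ⟩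
        R * (n * a + 2 * (n * a))             ≡⟨ triple R (n * a) ⟩
        3 * R * (n * a)                       ∎
        where
        open ≤-Reasoning
        s : ℕ → ℕ
        s r = length (neighbours r) / R
        triple : ∀ R x → R * (x + 2 * x) ≡ 3 * R * x
        triple = solve-∀
        length≤ : ∀ r → length (neighbours r) ≤ R * suc (s r)
        length≤ r = begin
          d                  ≡⟨ m≡m%n+[m/n]*n d R ⟩
          d % R + s r * R    ≤⟨ +-monoˡ-≤ (s r * R) (<⇒≤ (m%n<n d R)) ⟩
          suc (s r) * R      ≡⟨ *-comm (suc (s r)) R ⟩
          R * suc (s r)      ∎
          where d = length (neighbours r)
        -- A crude form of Young's inequality, taking the place of Hölder's: bound the product by
        -- the power of the larger of `a` and `x`.
        a^t*s≤ : ∀ x → a ^ t * x ≤ a ^ suc t + x ^ suc t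
        a^t*s≤ x with ≤-total x a
        ... | inj₁ x≤a = ≤-trans (≤-trans (*-monoʳ-≤ (a ^ t) x≤a) (≤-reflexive (*-comm (a ^ t) a)))
          (m≤m+n _ _)
        ... | inj₂ a≤x = ≤-trans (≤-trans (*-monoˡ-≤ x (^-monoˡ-≤ t a≤x)) (≤-reflexive (*-comm (x ^ t) x)))
          (m≤n+m _ _)
        rearrange : ∀ a b n → n * (a * b) + n * (a * b) ≡ b * (2 * (n * a))
        rearrange = solve-∀
        ∑s≤ : ∑ n s ≤ 2 * (n * a)
        ∑s≤ = *-cancelˡ-≤ (a ^ t) {{m^n≢0 a t}} (begin
          a ^ t * ∑ n s                            ≡⟨ ∑-*ˡ n (a ^ t) s ⟨
          ∑ n (λ r → a ^ t * s r)                  ≤⟨ ∑-mono n (λ r _ → a^t*s≤ (s r)) ⟩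
          ∑ n (λ r → a ^ suc t + s r ^ suc t)      ≡⟨ ∑-+ n (λ _ → a ^ suc t) (λ r → s r ^ suc t) ⟩
          ∑ n (λ _ → a ^ suc t) + ∑ n (λ r → s r ^ suc t)
            ≤⟨ +-mono-≤ (≤-reflexive (∑-const n (a ^ suc t))) ∑-power≤ ⟩
          n * a ^ suc t + n ^ suc t * (2 ^ D * B ^ k)
            ≡⟨ cong (n * a ^ suc t +_) (*-assoc n (n ^ t) _) ⟩
          n * a ^ suc t + n * (n ^ t * (2 ^ D * B ^ k))
            ≤⟨ +-monoʳ-≤ (n * a ^ suc t) (*-monoʳ-≤ n a-large) ⟩
          n * (a * a ^ t) + n * (a * a ^ t)        ≡⟨ rearrange a (a ^ t) n ⟩
          a ^ t * (2 * (n * a))                    ∎)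

  -- Powers

  ^-distribʳ-* : ∀ n a b → (a * b) ^ n ≡ a ^ n * b ^ n
  ^-distribʳ-* zero    a b = refl
  ^-distribʳ-* (suc n) a b = trans (cong (a * b *_) (^-distribʳ-* n a b))
    (interchange a b (a ^ n) (b ^ n))
    where
    interchange : ∀ a b c d → a * b * (c * d) ≡ a * c * (b * d)
    interchange = solve-∀

  ^-cancelʳ-≤ : ∀ n .{{_ : NonZero n}} {a b} → a ^ n ≤ b ^ n → a ≤ b
  ^-cancelʳ-≤ n {a} {b} a^n≤b^n = ≮⇒≥ λ b<a → <⇒≱ (^-monoˡ-< n b<a) a^n≤b^n

  -- Induction on `x`: keep the root `a` while its power suffices, else pass to `suc a`. In the
  -- latter case `a ^ d < suc x`, and `suc a ≤ 2 * a` as `a` is positive.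
  approximateRoot : ∀ d .{{_ : NonZero d}} x .{{_ : NonZero x}} →
    ∃ λ a → NonZero a × x ≤ a ^ d × a ^ d ≤ 2 ^ d * x
  approximateRoot d 1 = 1 , _ , ≤-reflexive (sym (^-zeroˡ d)) ,
    ≤-trans (≤-reflexive (^-zeroˡ d)) (*-mono-≤ (m^n>0 2 d) ≤-refl)
  approximateRoot d (suc x@(suc _)) with approximateRoot d x
  ... | suc a′ , _ , lo , hi with suc x ≤? suc a′ ^ d
  ...   | yes lo′ = suc a′ , _ , lo′ , ≤-trans hi (*-monoʳ-≤ (2 ^ d) (n≤1+n x))
  ...   | no  x≮  = suc a , _ , ≤-<-trans lo (^-monoˡ-< d (n<1+n a)) , (begin
    suc a ^ d      ≤⟨ ^-monoˡ-≤ d (s≤s (m≤n+m a a′)) ⟩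
    (a + a) ^ d  ≡⟨ cong (λ z → (a + z) ^ d) (+-identityʳ a) ⟨
    (2 * a) ^ d    ≡⟨ ^-distribʳ-* d 2 a ⟩
    2 ^ d * a ^ d  ≤⟨ *-monoʳ-≤ (2 ^ d) (<⇒≤ (≰⇒> x≮)) ⟩
    2 ^ d * suc x  ∎)
    where
    open ≤-Reasoning
    a = suc a′

  -- This dictates the choice `D = suc (k * F)`: the surplus `1 + k * F` in the exponent is exactly
  -- `D`, so it costs a single factor `n` after a `D`-th root.
  exponent-identity : ∀ T t k F → 1 + ((T + t) * suc (k * F) + k) * F ≡
    (1 + (T + t) * F) * suc (k * F)
  exponent-identity = solve-∀

  -- Here `T + t` is twice `T` minus one, so the conclusion is the desired bound with denominators
  -- cleared. It is proved for `D`-th powers because `B` is controlled only through `B ^ D`.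
  combineBounds : ∀ t k e f {n w a B c} →
    let T = suc t; F = suc f; D = suc (k * F) in
    w ≤ c * (n * a) → a ^ T ≤ 2 ^ T * (n ^ t * (2 ^ D * B ^ k)) → B ^ D ≤ 2 ^ D * n →
    ((c ^ T * 2 ^ T * 2 ^ D) ^ D * (2 ^ D) ^ k) ^ F < n →
    w ^ (T * F) ≤ n ^ ((T + t) * F + suc e * T)
  combineBounds t k e f {n@(suc _)} {w} {a} {B} {c} w≤ a≤ B≤ n> = ^-cancelʳ-≤ D (begin
    (w ^ (T * F)) ^ D                           ≡⟨ ^-*-assoc w (T * F) D ⟩
    w ^ (T * F * D)                             ≡⟨ cong (w ^_) (reorder T F D) ⟩
    w ^ (T * D * F)                             ≡⟨ ^-*-assoc w (T * D) F ⟨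
    (w ^ (T * D)) ^ F                           ≡⟨ cong (_^ F) (^-*-assoc w T D) ⟨
    ((w ^ T) ^ D) ^ F                           ≤⟨ ^-monoˡ-≤ F w^T^D≤ ⟩
    (K * n ^ ((T + t) * D + k)) ^ F         ≡⟨ ^-distribʳ-* F K _ ⟩
    K ^ F * (n ^ ((T + t) * D + k)) ^ F     ≡⟨ cong (K ^ F *_) (^-*-assoc n ((T + t) * D + k) F) ⟩
    -- All constants together are absorbed by one factor `n`.
    K ^ F * n ^ (((T + t) * D + k) * F)     ≤⟨ *-monoˡ-≤ _ (<⇒≤ n>) ⟩
    n ^ (1 + ((T + t) * D + k) * F)       ≡⟨ cong (n ^_) (exponent-identity T t k F) ⟩
    -- The remaining factor `n` fits because `suc e * T` is at least 1.
    n ^ ((1 + (T + t) * F) * D)             ≤⟨ ^-monoʳ-≤ n (*-monoˡ-≤ D (≤-trans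
                                                     (≤-reflexive (+-comm 1 _))
                                                     (+-monoʳ-≤ ((T + t) * F) (s≤s z≤n)))) ⟩
    n ^ (((T + t) * F + suc e * T) * D)     ≡⟨ ^-*-assoc n ((T + t) * F + suc e * T) D ⟨
    (n ^ ((T + t) * F + suc e * T)) ^ D     ∎)
    where
    open ≤-Reasoning
    T = suc t
    F = suc f
    D = suc (k * F)
    C = c ^ T * 2 ^ T * 2 ^ D
    K = C ^ D * (2 ^ D) ^ k
    reorder : ∀ x y z → x * y * z ≡ x * z * y
    reorder = solve-∀
    collect : ∀ c n′ p n″ q b → c * (n′ * (p * (n″ * (q * b)))) ≡ c * p * q * (n′ * n″) * b
    collect = solve-∀
    collect′ : ∀ C N p n → C * N * (p * n) ≡ C * p * (N * n)
    collect′ = solve-∀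
    w^T≤ : w ^ T ≤ C * n ^ (T + t) * B ^ k
    w^T≤ = begin
      w ^ T                                     ≤⟨ ^-monoˡ-≤ T w≤ ⟩
      (c * (n * a)) ^ T                         ≡⟨ ^-distribʳ-* T c (n * a) ⟩
      c ^ T * (n * a) ^ T                       ≡⟨ cong (c ^ T *_) (^-distribʳ-* T n a) ⟩
      c ^ T * (n ^ T * a ^ T)                   ≤⟨ *-monoʳ-≤ (c ^ T) (*-monoʳ-≤ (n ^ T) a≤) ⟩
      c ^ T * (n ^ T * (2 ^ T * (n ^ t * (2 ^ D * B ^ k))))
                                                ≡⟨ collect (c ^ T) (n ^ T) (2 ^ T) (n ^ t) (2 ^ D) (B ^ k) ⟩
      C * (n ^ T * n ^ t) * B ^ k               ≡⟨ cong (λ z → C * z * B ^ k) (^-distribˡ-+-* n T t) ⟨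
      C * n ^ (T + t) * B ^ k                 ∎
    w^T^D≤ : (w ^ T) ^ D ≤ K * n ^ ((T + t) * D + k)
    w^T^D≤ = begin
      (w ^ T) ^ D                               ≤⟨ ^-monoˡ-≤ D w^T≤ ⟩
      (C * n ^ (T + t) * B ^ k) ^ D           ≡⟨ ^-distribʳ-* D (C * n ^ (T + t)) (B ^ k) ⟩
      (C * n ^ (T + t)) ^ D * (B ^ k) ^ D     ≡⟨ cong (_* (B ^ k) ^ D) (^-distribʳ-* D C _) ⟩
      C ^ D * (n ^ (T + t)) ^ D * (B ^ k) ^ D
        ≡⟨ cong₂ (λ x y → C ^ D * x * y) (^-*-assoc n (T + t) D)
             (trans (^-*-assoc B k D) (trans (cong (B ^_) (*-comm k D)) (sym (^-*-assoc B D k)))) ⟩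
      C ^ D * n ^ ((T + t) * D) * (B ^ D) ^ k ≤⟨ *-monoʳ-≤ (C ^ D * n ^ ((T + t) * D)) (^-monoˡ-≤ k B≤) ⟩
      C ^ D * n ^ ((T + t) * D) * (2 ^ D * n) ^ k
        ≡⟨ cong (C ^ D * n ^ ((T + t) * D) *_) (^-distribʳ-* k (2 ^ D) n) ⟩
      C ^ D * n ^ ((T + t) * D) * ((2 ^ D) ^ k * n ^ k)
        ≡⟨ collect′ (C ^ D) _ ((2 ^ D) ^ k) (n ^ k) ⟩
      K * (n ^ ((T + t) * D) * n ^ k)         ≡⟨ cong (K *_) (^-distribˡ-+-* n ((T + t) * D) k) ⟨
      K * n ^ ((T + t) * D + k)             ∎

-- Rational exponents

open import Data.Integer.Base as ℤ using (+_; -[1+_])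
import Data.Integer.Properties as ℤ
open import Data.Rational.Unnormalised.Base
  using (ℚᵘ; mkℚᵘ; 0ℚᵘ; _+_; _-_; _/_; _<_; *<*)

-- Rational arithmetic does not reduce fractions: the exponent has denominator `suc t * suc f`, and
-- its numerator is the exponent of `n` in the hypothesis, both up to stray zeros.
≤-^^ : ∀ t e f {x n} → x ^ (suc t * suc f) ≤ n ^ ((suc t ℕ.+ t) * suc f ℕ.+ suc e * suc t) →
  x ≤ n ^^ (+ 2 / 1 - + 1 / suc t + mkℚᵘ (+ suc e) f)
≤-^^ t e f {x} {n} h = subst (λ z → x ≤ n ^^ mkℚᵘ z (f ℕ.+ (t ℕ.+ 0) * suc f)) (sym numerator)
  (subst₂ (λ b a → x ^ b ≤ n ^ a)
    (cong (λ z → suc z * suc f) (sym (+-identityʳ t))) (rearrange t e f) h)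
  where
  numerator : _ ≡ + ((t ℕ.+ suc (t ℕ.+ 0)) * suc f ℕ.+ suc e * suc (t ℕ.+ 0))
  numerator = cong (ℤ._+ (+ (suc e * suc (t ℕ.+ 0)))) (ℤ.+◃n≡+n ((t ℕ.+ suc (t ℕ.+ 0)) * suc f))
  rearrange : ∀ t e f → (suc t ℕ.+ t) * suc f ℕ.+ suc e * suc t ≡
    (t ℕ.+ suc (t ℕ.+ 0)) * suc f ℕ.+ suc e * suc (t ℕ.+ 0)
  rearrange = solve-∀

-- The maximum is either its default 0 or the weight of some avoider.
ex-bounded : ∀ {k l n} (A : Matrix k l) (P : ℕ → Set) → P 0 →
  (∀ (M : Matrix n n) → ¬ Contains M A → P (weight M)) → P (ex n A)
ex-bounded {n = n} A P P0 h with argmax-sel id 0 (List.map weight (avoiders n A))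
... | inj₁ ex≡0 = subst P (sym ex≡0) P0
... | inj₂ ex∈ with ∈-map⁻ weight ex∈
...   | M , M∈ , eq with ∈-filter⁻ (λ N → ¬? (contains? N A)) {xs = allMatrices n n} M∈
...     | _ , M∌A = subst P (sym eq) (h M M∌A)

theorem1p4 : (t : ℕ) .{{_ : NonZero t}} {k l : ℕ} (A : Matrix k l) →
    (∀ i → ones (row A i) ≤ t) →
    ∀ (ε : ℚᵘ) → 0ℚᵘ < ε →
    ∃ λ (n₀ : ℕ) → ∀ (n : ℕ) → n ≥ n₀ →
    ex n A ≤ n ^^ (+ 2 / 1 - + 1 / t + ε)
theorem1p4 zero {{t≢0}} = contradiction refl (≢-nonZero⁻¹ 0 {{t≢0}})
theorem1p4 (suc t) A A≤t (mkℚᵘ (+ zero) f) (*<* (ℤ.+<+ ()))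
theorem1p4 (suc t) A A≤t (mkℚᵘ -[1+ e ] f) (*<* ())
theorem1p4 (suc t) {k} {l} A A≤t (mkℚᵘ (+ suc e) f) _ = suc n₁ , λ n n>n₁ →
  ≤-^^ t e f (ex-bounded A (λ x → x ^ (suc t * suc f) ≤ n ^ ((suc t ℕ.+ t) * suc f ℕ.+ suc e * suc t))
    z≤n (λ M M∌A → bound M M∌A n>n₁))
  where
  -- For `B` near the `D`-th root of `n`, the factor `B ^ k` is about `n` to the power `k / D`,
  -- which is less than `1 / suc f`.
  D = suc (k * suc f)
  c = 3 * suc (iteratedRamseyNumber (suc t) (l ℕ.+ suc t) D)
  n₁ = ((c ^ suc t * 2 ^ suc t * 2 ^ D) ^ D * (2 ^ D) ^ k) ^ suc f
  bound : ∀ {n} (M : Matrix n n) → ¬ Contains M A → n₁ ℕ.< n →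
    weight M ^ (suc t * suc f) ≤ n ^ ((suc t ℕ.+ t) * suc f ℕ.+ suc e * suc t)
  -- `n` is positive since it exceeds `n₁`. Up to a factor 2, `B` is the `D`-th root of `n`, and `a`
  -- is the `suc t`-th root of the quantity that `weight≤` requires it to dominate.
  bound {n@(suc _)} M M∌A n>n₁ with approximateRoot D n
  ... | B@(suc _) , _ , n≤B^D , B^D≤
    with approximateRoot (suc t) (n ^ t * (2 ^ D * B ^ k))
           {{m*n≢0 _ _ {{m^n≢0 n t}} {{m*n≢0 _ _ {{m^n≢0 2 D}} {{m^n≢0 B k}}}}}}
  ...   | a@(suc _) , _ , a-large , a-small =
    combineBounds t k e f (Avoiding.weight≤ M A t A≤t B D n≤B^D M∌A a a-large) a-small B^D≤ n>n₁
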